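{- For every integer $n\geqslant 0$, $$u_0(n)=u_1(n)-u_2(n).$$
   Context: A composition of a positive integer $n$ is a sequence $\lambda=(\lambda_1,\lambda_2,\ldots,\lambda_k)$ of positive integers (called parts) whose sum is $n$. The composition is unimodal if there exists $t\in\{1,2,\ldots,k\}$ such that $\lambda_1\leqslant\lambda_2\leqslant\cdots\leqslant\lambda_t$ and $\lambda_t\geqslant\lambda_{t+1}\geqslant\cdots\geqslant\lambda_k$. For $n\geqslant 1$, $u_0(n)$ is the number of unimodal compositions of $n$, and $u_0(0)=0$. For $m\geqslant 1$ and $n\geqslant 0$, $u_m(n)$ is the number of unimodal compositions of $n+m$ in which the maximal part appears exactly $m$ times; in particular $u_m(0)=1$. -}

module Defs where

open import Data.Empty using (⊥)
open import Data.Fin using (Fin; toℕ)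
open import Data.Fin.Properties using (any?)
open import Data.List using (List; []; _∷_; _++_; map; length; filter; take; drop)
open import Data.List.Extrema.Nat using (max)
open import Data.List.Membership.Propositional using (_∈_)
open import Data.List.Membership.Propositional.Properties using (∈-map⁺; ∈-map⁻; ∈-++⁺ˡ; ∈-++⁺ʳ; ∈-++⁻)
open import Data.List.Properties using (∷-injectiveʳ)
open import Data.List.Relation.Unary.All using (All; []; _∷_)
open import Data.List.Relation.Unary.Any using (here; there)
open import Data.List.Relation.Unary.Linked using (Linked; linked?)
open import Data.List.Relation.Unary.Unique.Propositional using (Unique; []; _∷_)
open import Data.List.Relation.Unary.Unique.Propositional.Properties using (map⁺; ++⁺)
open import Data.Nat using (ℕ; zero; suc; _+_; _≤_; _≥_; NonZero; z≤n; s≤s; _≟_; _≤?_; _≥?_)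
open import Data.Nat.ListAction using (sum)
open import Data.Nat.Properties using (+-suc; +-identityʳ; ≤-refl; ≤-trans; n≤1+n; 1+n≰n; m≤n⇒m<n∨m≡n; +-cancelˡ-≡; m≤m+n)
open import Data.Product using (∃; _×_; _,_)
open import Data.Sum using (inj₁; inj₂)
open import Function.Bundles using (_⇔_; mk⇔)
open import Relation.Binary.PropositionalEquality using (_≡_; refl; sym; trans; cong; subst)
open import Relation.Nullary using (Dec; ¬_; contradiction)
open import Relation.Nullary.Decidable using (_×-dec_)

IsComposition : ℕ → List ℕ → Set
IsComposition n xs = All NonZero xs × sum xs ≡ n

-- The peak index t is 0-based, so  take (suc t)  is λ₁,…,λ_{t+1}  and
-- drop t  is  λ_{t+1},…,λ_k : both sublists contain the peak.
-- The empty list is not unimodal, having no peak.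
Unimodal : List ℕ → Set
Unimodal xs = ∃ λ (t : Fin (length xs)) →
  Linked _≤_ (take (suc (toℕ t)) xs) × Linked _≥_ (drop (toℕ t) xs)

unimodal? : ∀ xs → Dec (Unimodal xs)
unimodal? xs = any? λ t →
  linked? _≤?_ (take (suc (toℕ t)) xs) ×-dec linked? _≥?_ (drop (toℕ t) xs)

-- 0 is only the value of the maximum on the empty list; it does not affect
-- the maximum of a nonempty one.
maxPart : List ℕ → ℕ
maxPart = max 0

maxMultiplicity : List ℕ → ℕ
maxMultiplicity xs = length (filter (_≟ maxPart xs) xs)

-- The compositions of p + r whose first part is at least p (for p ≥ 1):
-- the first part is p, or it is at least p + 1.
compositionsFrom : ℕ → ℕ → List (List ℕ)
compositionsFrom p zero    = (p ∷ []) ∷ []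
compositionsFrom p (suc r) =
  map (p ∷_) (compositionsFrom 1 r) ++ compositionsFrom (suc p) r

-- Lists every composition of n exactly once: see ∈-compositions and
-- compositions-unique below.
compositions : ℕ → List (List ℕ)
compositions zero    = [] ∷ []
compositions (suc n) = compositionsFrom 1 n

-- u m n is u_m(n).
u : ℕ → ℕ → ℕ
u zero    zero    = 0
u zero    (suc n) = length (filter unimodal? (compositions (suc n)))
u (suc m) n       =
  length (filter (λ xs → unimodal? xs ×-dec (maxMultiplicity xs ≟ suc m))
                 (compositions (n + suc m)))

private
  FirstAtLeast : ℕ → List ℕ → Set
  FirstAtLeast p []      = ⊥
  FirstAtLeast p (x ∷ _) = p ≤ x

  weaken : ∀ {p} xs → FirstAtLeast (suc p) xs → FirstAtLeast p xs
  weaken (x ∷ _) q = ≤-trans (n≤1+n _) q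

  sound : ∀ p r {xs} → xs ∈ compositionsFrom (suc p) r →
          IsComposition (suc p + r) xs × FirstAtLeast (suc p) xs
  sound p zero (here refl) = (_ ∷ [] , refl) , ≤-refl
  sound p (suc r) {xs} i with ∈-++⁻ (map (suc p ∷_) (compositionsFrom 1 r)) i
  ... | inj₁ j with ∈-map⁻ (suc p ∷_) j
  ...   | ys , k , refl with sound 0 r k
  ...     | (a , e) , _ = (_ ∷ a , cong (suc p +_) e) , ≤-refl
  sound p (suc r) {xs} i | inj₂ j with sound (suc p) r j
  ... | (a , e) , f = (a , trans e (sym (+-suc (suc p) r))) , weaken xs f

  nonempty-first : ∀ {n} xs → IsComposition (suc n) xs → FirstAtLeast 1 xs
  nonempty-first (suc x ∷ xs) _ = s≤s z≤n
  nonempty-first (zero ∷ _) (() ∷ _ , _)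

  complete : ∀ p r xs → IsComposition (suc p + r) xs → FirstAtLeast (suc p) xs →
             xs ∈ compositionsFrom (suc p) r
  complete p r (x ∷ xs) (a , e) f with m≤n⇒m<n∨m≡n f
  complete p zero (x ∷ xs) (a , e) f | inj₁ g =
    contradiction
      (≤-trans g (subst (x ≤_) (trans e (+-identityʳ (suc p))) (m≤m+n x (sum xs))))
      1+n≰n
  complete p (suc r) (x ∷ xs) (a , e) f | inj₁ g =
    ∈-++⁺ʳ _ (complete (suc p) r (x ∷ xs) (a , trans e (+-suc (suc p) r)) g)
  complete p zero (.(suc p) ∷ []) _ f | inj₂ refl = here refl
  complete p zero (.(suc p) ∷ zero ∷ _) (_ ∷ () ∷ _ , _) f | inj₂ refl
  complete p zero (.(suc p) ∷ suc y ∷ ys) (_ , e) f | inj₂ refl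
    with () ← +-cancelˡ-≡ (suc p) (suc y + sum ys) 0 e
  complete p (suc r) (.(suc p) ∷ xs) (_ ∷ a , e) f | inj₂ refl =
    ∈-++⁺ˡ (∈-map⁺ (suc p ∷_) (complete 0 r xs c (nonempty-first xs c)))
    where
    c : IsComposition (suc r) xs
    c = a , +-cancelˡ-≡ (suc p) (sum xs) (suc r) e

  unique : ∀ p r → Unique (compositionsFrom (suc p) r)
  unique p zero    = [] ∷ []
  unique p (suc r) = ++⁺ (map⁺ ∷-injectiveʳ (unique 0 r)) (unique (suc p) r) disjoint
    where
    disjoint : ∀ {xs} → ¬ (xs ∈ map (suc p ∷_) (compositionsFrom 1 r) ×
                           xs ∈ compositionsFrom (suc (suc p)) r)
    disjoint (i , j) with ∈-map⁻ (suc p ∷_) i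
    ... | _ , _ , refl with sound (suc p) r j
    ...   | _ , f = 1+n≰n f

∈-compositions : ∀ n xs → xs ∈ compositions n ⇔ IsComposition n xs
∈-compositions zero xs = mk⇔ to (from xs)
  where
  to : xs ∈ compositions 0 → IsComposition 0 xs
  to (here refl) = [] , refl
  from : ∀ xs → IsComposition 0 xs → xs ∈ compositions 0
  from []            _       = here refl
  from (suc _ ∷ _) (_ , ())
  from (zero ∷ _) (() ∷ _ , _)
∈-compositions (suc n) xs = mk⇔
  (λ i → let c , _ = sound 0 n i in c)
  (λ c → complete 0 n xs c (nonempty-first xs c))

compositions-unique : ∀ n → Unique (compositions n)
compositions-unique zero    = [] ∷ []
compositions-unique (suc n) = unique 0 n

{-# OPTIONS --safe #-}
-- For n ≥ 1 raise the last maximal part of a unimodal composition of n by one,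
-- or lower the second of the two maximal parts of one counted by u₂(n).  Both
-- give unimodal compositions of n + 1 with a single maximal part M, and each of
-- these arises exactly once: from the second kind if the part following M
-- is M − 1, and from the first kind otherwise.
module Submission where

open import Data.Fin using (zero; suc)
open import Data.Integer using (+_; _-_; _⊖_)
open import Data.Integer.Properties using (m-n≡m⊖n; ⊖-≥)
open import Data.List using (List; []; _∷_; _∷ʳ_; _++_; map; length; filter; head; drop)
open import Data.List.Extrema.Nat using (max≈v⁺)
open import Data.List.Membership.Propositional using (_∈_)
open import Data.List.Membership.Propositional.Properties
  using (∈-map⁺; ∈-map⁻; ∈-++⁺ˡ; ∈-++⁺ʳ; ∈-++⁻; ∈-filter⁺; ∈-filter⁻; ∈-insert)
open import Data.List.Membership.Propositional.Properties.WithK using (unique∧set⇒bag)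
open import Data.List.Properties
  using (length-map; length-++; map-∘; map-id-local; filter-none; filter-++;
         filter-accept; filter-reject; ++-assoc)
open import Data.List.Relation.Binary.BagAndSetEquality using (_∼[_]_; set; ∼bag⇒↭)
open import Data.List.Relation.Binary.Disjoint.Propositional using (Disjoint)
open import Data.List.Relation.Binary.Permutation.Propositional.Properties using (↭-length)
open import Data.List.Relation.Unary.All as All using (All; []; _∷_; all?)
import Data.List.Relation.Unary.All.Properties as All
open import Data.List.Relation.Unary.Linked as Linked using (Linked; []; [-]; _∷_)
open import Data.List.Relation.Unary.Linked.Properties using (Linked⇒All)
open import Data.List.Relation.Unary.Unique.Propositional using (Unique)
import Data.List.Relation.Unary.Unique.Propositional.Properties as Unique
open import Data.Maybe using (just)
open import Data.Maybe.Relation.Binary.Connected using (Connected; just)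
open import Data.Nat
open import Data.Nat.ListAction using (sum)
open import Data.Nat.Properties
open import Data.Product using (∃; _×_; _,_; proj₂; map₁; uncurry)
open import Data.Sum using (inj₁; inj₂)
open import Function using (_∘_; _⇔_; mk⇔; Equivalence)
open import Relation.Binary.PropositionalEquality
open import Relation.Nullary using (Dec; yes; no; contradiction)
open import Relation.Nullary.Decidable using (_×-dec_)
open import Defs

private
  variable
    a m n x y : ℕ
    α β xs ys : List ℕ

-- Lists without repetition: injectivity on members and equality of lengths.

-- The left inverse is required only on the members of `xs`, because the maps used below are not
-- injective on all lists.
Unique-map : ∀ {A B : Set} {f : A → B} (g : B → A) {xs} →
             (∀ {x} → x ∈ xs → g (f x) ≡ x) → Unique xs → Unique (map f xs)
Unique-map {f = f} g {xs} inv u = Unique.map⁻ {f = g}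
  (subst Unique (sym (trans (sym (map-∘ xs)) (map-id-local (All.tabulate inv)))) u)

length-set-≡ : ∀ {A : Set} {xs ys : List A} → Unique xs → Unique ys →
               xs ∼[ set ] ys → length xs ≡ length ys
length-set-≡ u v e = ↭-length (∼bag⇒↭ (unique∧set⇒bag u v e))

-- Unimodal lists cut at a peak.

-- The two strict bounds are independent: around a peak `m`, taking a bound to be `m` or `suc m`
-- forbids or allows further copies of `m` on that side.
record Flanks (a : ℕ) (α : List ℕ) (b : ℕ) (β : List ℕ) : Set where
  constructor flanks
  field
    ascending  : Linked _≤_ α
    leftBound  : All (_< a) α
    descending : Linked _≥_ β
    rightBound : All (_< b) β

widen : All (_< a) xs → All (_< suc a) xs
widen = All.map m<n⇒m<1+n

∷-descending : All (_< suc x) β → Linked _≥_ β → Linked _≥_ (x ∷ β)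
∷-descending []        _ = [-]
∷-descending (s≤s p ∷ _) l = p ∷ l

descending⇒bounded : Linked _≥_ (x ∷ β) → All (_< suc x) β
descending⇒bounded l =
  All.map s≤s (All.tail (Linked⇒All (λ p q → ≤-trans q p) ≤-refl l))

ascending⇒bounded : Linked _≤_ (x ∷ β) → All (x ≤_) β
ascending⇒bounded l = All.tail (Linked⇒All ≤-trans ≤-refl l)

data LastPeak : List ℕ → Set where
  lastPeak : ∀ α m β → Flanks (suc m) α m β → LastPeak (α ++ m ∷ β)

data SinglePeak : List ℕ → Set where
  singlePeak : ∀ α m β → Flanks m α m β → SinglePeak (α ++ m ∷ β)

data DoublePeak : List ℕ → Set where
  doublePeak : ∀ α m β → Flanks m α m β → DoublePeak (α ++ m ∷ m ∷ β)

∷-lastPeak : Connected _≤_ (just x) (head xs) → LastPeak xs → LastPeak (x ∷ xs)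
∷-lastPeak {x} (just p) (lastPeak [] m β (flanks _ _ d r)) =
  lastPeak (x ∷ []) m β (flanks [-] (s≤s p ∷ []) d r)
∷-lastPeak {x} (just p) (lastPeak α@(_ ∷ _) m β (flanks as l@(q ∷ _) d r)) =
  lastPeak (x ∷ α) m β (flanks (p ∷ as) (≤-<-trans p q ∷ l) d r)

-- The last maximum ends the initial run of entries equal to the head, so the recursion continues as
-- long as the head is repeated.
descending⇒lastPeak : Linked _≥_ (x ∷ xs) → LastPeak (x ∷ xs)
descending⇒lastPeak {x} [-] = lastPeak [] x [] (flanks [] [] [] [])
descending⇒lastPeak {x} {y ∷ ys} (p ∷ l) with m≤n⇒m<n∨m≡n p
... | inj₁ q = lastPeak [] x (y ∷ ys)
  (flanks [] [] l (q ∷ All.map (λ r → <-≤-trans r q) (descending⇒bounded l)))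
... | inj₂ refl = ∷-lastPeak (just ≤-refl) (descending⇒lastPeak l)

unimodal⇒lastPeak : ∀ xs → Unimodal xs → LastPeak xs
unimodal⇒lastPeak (x ∷ xs)     (zero  , _     , d) = descending⇒lastPeak d
unimodal⇒lastPeak (x ∷ y ∷ xs) (suc t , p ∷ l , d) =
  ∷-lastPeak (just p) (unimodal⇒lastPeak (y ∷ xs) (t , l , d))

∷-unimodal : Connected _≤_ (just x) (head xs) → Unimodal xs → Unimodal (x ∷ xs)
∷-unimodal {xs = y ∷ xs} (just p) (t , l , d) = suc t , p ∷ l , d

flanks⇒unimodal : Flanks (suc m) α (suc m) β → Unimodal (α ++ m ∷ β)
flanks⇒unimodal {α = []} (flanks _ _ d r) = zero , [-] , ∷-descending r d
-- Only the last entry of the left flank meets the peak, and its bound supplies that comparison;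
-- earlier entries are compared with their neighbours.
flanks⇒unimodal {α = x ∷ []} (flanks _ (s≤s p ∷ _) d r) =
  ∷-unimodal (just p) (flanks⇒unimodal (flanks [] [] d r))
flanks⇒unimodal {α = x ∷ y ∷ α} (flanks (p ∷ as) (_ ∷ l) d r) =
  ∷-unimodal (just p) (flanks⇒unimodal (flanks as l d r))

lastPeak⇒unimodal : LastPeak xs → Unimodal xs
lastPeak⇒unimodal (lastPeak _ _ _ (flanks as l d r)) =
  flanks⇒unimodal (flanks as l d (widen r))

-- Multiplicity of the maximal part.

count : ℕ → List ℕ → ℕ
count m xs = length (filter (_≟ m) xs)

count-++ : ∀ m xs ys → count m (xs ++ ys) ≡ count m xs + count m ys
count-++ m xs ys =
  trans (cong length (filter-++ (_≟ m) xs ys)) (length-++ (filter (_≟ m) xs))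

count-self : ∀ m xs → count m (m ∷ xs) ≡ suc (count m xs)
count-self m xs = cong length (filter-accept (_≟ m) refl)

count-other : x ≢ m → ∀ xs → count m (x ∷ xs) ≡ count m xs
count-other {m = m} p xs = cong length (filter-reject (_≟ m) p)

count-bounded : All (_< m) xs → count m xs ≡ 0
count-bounded {m} p = cong length (filter-none (_≟ m) (All.map <⇒≢ p))

count≡0⇒bounded : All (_< suc m) xs → count m xs ≡ 0 → All (_< m) xs
count≡0⇒bounded [] _ = []
count≡0⇒bounded {m} {x ∷ xs} (s≤s p ∷ ps) e with m≤n⇒m<n∨m≡n p
... | inj₁ q = q ∷ count≡0⇒bounded ps (trans (sym (count-other (<⇒≢ q) xs)) e)
... | inj₂ refl = contradiction (trans (sym e) (count-self x xs)) 0≢1+n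

maxPart-peak : All (_< suc m) α → All (_< suc m) β → maxPart (α ++ m ∷ β) ≡ m
maxPart-peak {α = α} l r = max≈v⁺ (∈-insert α)
  (All.++⁺ (All.map s≤s⁻¹ l) (≤-refl ∷ All.map s≤s⁻¹ r)) z≤n

maxMultiplicity-peak : All (_< suc m) α → All (_< suc m) β →
                       maxMultiplicity (α ++ m ∷ β) ≡ suc (count m α + count m β)
maxMultiplicity-peak {m} {α} {β} l r = begin
  count (maxPart (α ++ m ∷ β)) (α ++ m ∷ β)  ≡⟨ cong (λ k → count k (α ++ m ∷ β)) (maxPart-peak l r) ⟩
  count m (α ++ m ∷ β)                      ≡⟨ count-++ m α (m ∷ β) ⟩
  count m α + count m (m ∷ β)               ≡⟨ cong (_+_ (count m α)) (count-self m β) ⟩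
  count m α + suc (count m β)               ≡⟨ +-suc _ _ ⟩
  suc (count m α + count m β)               ∎
  where open ≡-Reasoning

maxMultiplicity-lastPeak : Flanks (suc m) α m β → maxMultiplicity (α ++ m ∷ β) ≡ suc (count m α)
maxMultiplicity-lastPeak {m} {α} (flanks _ l _ r)
  rewrite maxMultiplicity-peak l (widen r) | count-bounded r | +-identityʳ (count m α) = refl

-- Cutting at the last maximum puts every other copy into `α`. Multiplicity 1 says that there is
-- none, which sharpens the left bound from `suc m` to `m`.
singlePeak⇔ : ∀ xs → (Unimodal xs × maxMultiplicity xs ≡ 1) ⇔ SinglePeak xs
singlePeak⇔ xs = mk⇔ to from
  where
  to : Unimodal xs × maxMultiplicity xs ≡ 1 → SinglePeak xs
  to (u , e) with unimodal⇒lastPeak xs u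
  ... | lastPeak α m β f@(flanks as l d r) = singlePeak α m β
    (flanks as (count≡0⇒bounded l (suc-injective (trans (sym (maxMultiplicity-lastPeak f)) e))) d r)

  from : SinglePeak xs → Unimodal xs × maxMultiplicity xs ≡ 1
  from (singlePeak α m β (flanks as l d r)) =
    lastPeak⇒unimodal (lastPeak α m β f) ,
    trans (maxMultiplicity-lastPeak f) (cong suc (count-bounded l))
    where f = flanks as (widen l) d r

ascending-∷ʳ : Linked _≤_ α → All (_< suc m) α → Linked _≤_ (α ∷ʳ m)
ascending-∷ʳ []       _             = [-]
ascending-∷ʳ [-]      (s≤s p ∷ _)   = p ∷ [-]
ascending-∷ʳ (p ∷ as) (_ ∷ l)       = p ∷ ascending-∷ʳ as l

-- In an ascending list with entries at most `m`, whatever follows an `m` is again `m`, so a single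
-- copy must come last.
count≡1⇒∷ʳ : Linked _≤_ α → All (_< suc m) α → count m α ≡ 1 →
             ∃ λ α′ → α ≡ α′ ∷ʳ m × Linked _≤_ α′ × All (_< m) α′
count≡1⇒∷ʳ {x ∷ α} {m} as (s≤s p ∷ l) e with m≤n⇒m<n∨m≡n p
count≡1⇒∷ʳ {x ∷ []} as l e | inj₂ refl = [] , refl , [] , []
-- Here `x` is the only copy of `m`, so `y` is below `m`, against `x ≤ y`.
count≡1⇒∷ʳ {x ∷ y ∷ α} (p ∷ as) (_ ∷ l) e | inj₂ refl =
  contradiction p (<⇒≱ (All.head (count≡0⇒bounded l (suc-injective (trans (sym (count-self x (y ∷ α))) e)))))
count≡1⇒∷ʳ {x ∷ α} as (_ ∷ l) e | inj₁ q
  with count≡1⇒∷ʳ (Linked.tail as) l (trans (sym (count-other (<⇒≢ q) α)) e)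
... | []     , refl , _   , _ = x ∷ [] , refl , [-] , q ∷ []
... | y ∷ α′ , refl , as′ , l′ = x ∷ y ∷ α′ , refl , Linked.head as ∷ as′ , q ∷ l′

-- The copy other than the last maximum lies in the left flank, and ascent forces it to the end of
-- that flank, so the two are adjacent.
doublePeak⇔ : ∀ xs → (Unimodal xs × maxMultiplicity xs ≡ 2) ⇔ DoublePeak xs
doublePeak⇔ xs = mk⇔ to from
  where
  to : Unimodal xs × maxMultiplicity xs ≡ 2 → DoublePeak xs
  to (u , e) with unimodal⇒lastPeak xs u
  ... | lastPeak α m β f@(flanks as l d r)
    with count≡1⇒∷ʳ as l (suc-injective (trans (sym (maxMultiplicity-lastPeak f)) e))
  ... | α′ , refl , as′ , l′ =
    subst DoublePeak (sym (++-assoc α′ (m ∷ []) (m ∷ β))) (doublePeak α′ m β (flanks as′ l′ d r))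

  from : DoublePeak xs → Unimodal xs × maxMultiplicity xs ≡ 2
  from (doublePeak α m β (flanks as l d r)) =
    subst (λ ys → Unimodal ys × maxMultiplicity ys ≡ 2) (++-assoc α (m ∷ []) (m ∷ β))
      (lastPeak⇒unimodal (lastPeak _ m β f) ,
       trans (maxMultiplicity-lastPeak f) (cong suc c))
    where
    f : Flanks (suc m) (α ∷ʳ m) m β
    f = flanks (ascending-∷ʳ as (widen l)) (All.∷ʳ⁺ (widen l) ≤-refl) d r
    c : count m (α ∷ʳ m) ≡ 1
    c rewrite count-++ m α (m ∷ []) | count-bounded l | count-self m [] = refl

-- Raising and lowering the last maximum, with left inverses.

-- The first entry exceeding everything after it is the last maximum, so the cut is computable
-- without a proof of unimodality. The `0` is a default reached only from the empty list.
split : List ℕ → List ℕ × ℕ × List ℕ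
split []       = [] , 0 , []
split (x ∷ xs) with all? (_<? x) xs
... | yes _ = [] , x , xs
... | no  _ = map₁ (x ∷_) (split xs)

split-lastPeak : All (_< suc m) α → All (_< m) β → split (α ++ m ∷ β) ≡ (α , m , β)
split-lastPeak {m} {[]} {β} _ r with all? (_<? m) β
... | yes _ = refl
... | no ¬r = contradiction r ¬r
split-lastPeak {m} {x ∷ α} {β} (p ∷ l) r with all? (_<? x) (α ++ m ∷ β)
... | yes q = contradiction (All.head (All.++⁻ʳ α q)) (≤⇒≯ (s≤s⁻¹ p))
... | no  _ rewrite split-lastPeak l r = refl

raiseLastMax lowerLastMax doubleMax : List ℕ → List ℕ
raiseLastMax xs = let α , m , β = split xs in α ++ suc m ∷ β
lowerLastMax xs = let α , m , β = split xs in α ++ pred m ∷ β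
-- Left inverse of lowerLastMax on lists with a double peak.
doubleMax    xs = let α , m , β = split xs in α ++ m ∷ m ∷ drop 1 β

raiseLastMax-peak : All (_< suc m) α → All (_< m) β →
                    raiseLastMax (α ++ m ∷ β) ≡ α ++ suc m ∷ β
raiseLastMax-peak l r rewrite split-lastPeak l r = refl

lowerLastMax-peak : All (_< suc m) α → All (_< m) β →
                    lowerLastMax (α ++ m ∷ β) ≡ α ++ pred m ∷ β
lowerLastMax-peak l r rewrite split-lastPeak l r = refl

lowerLastMax-doublePeak : All (_< m) α → All (_< m) β →
                          lowerLastMax (α ++ m ∷ m ∷ β) ≡ α ++ m ∷ pred m ∷ β
lowerLastMax-doublePeak {m} {α} {β} l r
  -- Bracketing the first `m` with `α` makes the second one the last peak.
  rewrite sym (++-assoc α (m ∷ []) (m ∷ β))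
        | lowerLastMax-peak (All.∷ʳ⁺ (widen l) ≤-refl) r
  = ++-assoc α (m ∷ []) (pred m ∷ β)

doubleMax-peak : All (_< suc m) α → All (_< m) (x ∷ β) →
                 doubleMax (α ++ m ∷ x ∷ β) ≡ α ++ m ∷ m ∷ β
doubleMax-peak l r rewrite split-lastPeak l r = refl

-- The raised entry exceeds all others, so lowering acts at the same place.
lowerLastMax∘raiseLastMax : LastPeak xs → lowerLastMax (raiseLastMax xs) ≡ xs
lowerLastMax∘raiseLastMax (lastPeak α m β (flanks _ l _ r))
  rewrite raiseLastMax-peak l r = lowerLastMax-peak (widen l) (widen r)

NonZero-peak : ∀ α → All NonZero (α ++ m ∷ β) → NonZero m
NonZero-peak α p = All.head (All.++⁻ʳ α p)

doubleMax∘lowerLastMax : All NonZero xs → DoublePeak xs → doubleMax (lowerLastMax xs) ≡ xs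
-- Since `pred` fixes `0`, lowering would leave two equal maxima here; positivity of the parts
-- excludes this.
doubleMax∘lowerLastMax nz (doublePeak α zero β _) with () ← NonZero.nonZero (NonZero-peak α nz)
doubleMax∘lowerLastMax nz (doublePeak α (suc m) β (flanks _ l _ r))
  rewrite lowerLastMax-doublePeak l r = doubleMax-peak (widen l) (≤-refl ∷ r)

-- The part after the peak tells the images apart: below a peak `suc m`, a lowered list continues
-- with `m`, a raised one only with parts less than `m`.
raise≢lower : LastPeak xs → All NonZero ys → DoublePeak ys → raiseLastMax xs ≢ lowerLastMax ys
raise≢lower _ nz (doublePeak α zero β _) with () ← NonZero.nonZero (NonZero-peak α nz)
raise≢lower (lastPeak α m β (flanks _ l _ r)) nz (doublePeak α′ (suc m′) β′ (flanks _ l′ _ r′)) e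
  -- Applying `split` to both sides identifies `m` with `m′` and `β` with `m′ ∷ β′`, so the bound on
  -- `β` reads `m′ < m′`.
  with trans (sym (split-lastPeak (widen l) (widen r)))
      (trans (cong split (trans (trans (sym (raiseLastMax-peak l r)) e) (lowerLastMax-doublePeak l′ r′)))
             (split-lastPeak (widen l′) (≤-refl ∷ r′)))
... | refl = n≮n _ (All.head r)

-- Effect on compositions, and surjectivity.

sum-raise : ∀ α m β → sum (α ++ suc m ∷ β) ≡ suc (sum (α ++ m ∷ β))
sum-raise []      m β = refl
sum-raise (x ∷ α) m β = trans (cong (_+_ x) (sum-raise α m β)) (+-suc x _)

raise-composition : ∀ α → IsComposition n (α ++ m ∷ β) → IsComposition (suc n) (α ++ suc m ∷ β)
raise-composition {m = m} {β} α (nz , e) with All.++⁻ α nz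
... | p , _ ∷ q = All.++⁺ p (_ ∷ q) , trans (sum-raise α m β) (cong suc e)

lower-composition : .{{NonZero m}} → ∀ α → IsComposition (suc n) (α ++ suc m ∷ β) →
                    IsComposition n (α ++ m ∷ β)
lower-composition {m = suc m} {β = β} α (nz , e) with All.++⁻ α nz
... | p , _ ∷ q = All.++⁺ p (_ ∷ q) , suc-injective (trans (sym (sum-raise α (suc m) β)) e)

bounded-by-1⇒[] : All NonZero xs → All (_< 1) xs → xs ≡ []
bounded-by-1⇒[] []       []             = refl
bounded-by-1⇒[] (() ∷ _) (s≤s z≤n ∷ _)

raise-singlePeak : IsComposition n xs → LastPeak xs →
                   IsComposition (suc n) (raiseLastMax xs) × SinglePeak (raiseLastMax xs)
raise-singlePeak c (lastPeak α m β (flanks as l d r)) rewrite raiseLastMax-peak l r =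
  raise-composition α c , singlePeak α (suc m) β (flanks as l d (widen r))

lower-singlePeak : IsComposition (3 + n) xs → DoublePeak xs →
                   IsComposition (2 + n) (lowerLastMax xs) × SinglePeak (lowerLastMax xs)
lower-singlePeak (nz , _) (doublePeak α zero β _) with () ← NonZero.nonZero (NonZero-peak α nz)
-- A peak of `1` leaves both flanks empty: the list is 1, 1, whose lowering would contain a part 0,
-- but its sum 2 is not `3 + n`.
lower-singlePeak (nz , e) (doublePeak α 1 β (flanks _ l _ r))
  with refl ← bounded-by-1⇒[] (All.++⁻ˡ α nz) l
     | refl ← bounded-by-1⇒[] (All.tail (All.tail (All.++⁻ʳ α nz))) r
  with () ← e
lower-singlePeak {n} c (doublePeak α m@(suc (suc k)) β (flanks as l d r))
  rewrite lowerLastMax-doublePeak l r =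
    subst (IsComposition (2 + n)) (++-assoc α (m ∷ []) (suc k ∷ β))
      (lower-composition (α ∷ʳ m) (subst (IsComposition (3 + n)) (sym (++-assoc α (m ∷ []) (m ∷ β))) c)) ,
    -- The lowered copy becomes the head of the right flank, and the first `m` is left as the only
    -- maximum.
    singlePeak α m (suc k ∷ β) (flanks as l (∷-descending r d) (≤-refl ∷ r))

data Origin (n : ℕ) : List ℕ → Set where
  raised  : IsComposition n xs → LastPeak xs → Origin n (raiseLastMax xs)
  lowered : IsComposition (2 + n) xs → DoublePeak xs → Origin n (lowerLastMax xs)

-- Lowering the peak `suc k` gives a last maximum `k` if the right flank lies below `k`. Otherwise
-- that descending flank begins with `k`, and raising this entry gives a double peak.
origin : IsComposition (2 + n) xs → SinglePeak xs → Origin (suc n) xs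
origin (nz , _) (singlePeak α zero β _) with () ← NonZero.nonZero (NonZero-peak α nz)
-- A single peak of `1` is the whole list, whose sum 1 is not `2 + n`.
origin (nz , e) (singlePeak α 1 β (flanks _ l _ r))
  with refl ← bounded-by-1⇒[] (All.++⁻ˡ α nz) l
     | refl ← bounded-by-1⇒[] (All.tail (All.++⁻ʳ α nz)) r
  with () ← e
origin {n} c (singlePeak α m@(suc k@(suc _)) β (flanks as l d r)) with all? (_<? k) β
... | yes q = subst (Origin (suc n)) (raiseLastMax-peak l q)
  (raised (lower-composition α c) (lastPeak α k β (flanks as l d q)))
origin c (singlePeak α m@(suc k@(suc _)) [] _) | no ¬q = contradiction [] ¬q
origin {n} c (singlePeak α m@(suc k@(suc _)) (y ∷ β) (flanks as l d (s≤s p ∷ _))) | no ¬q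
  with m≤n⇒m<n∨m≡n p
-- By descent `y < k` would put the whole flank below `k`, which the test denied.
... | inj₁ y<k = contradiction
  (y<k ∷ All.map (λ z → <-≤-trans z y<k) (descending⇒bounded d)) ¬q
... | inj₂ refl = subst (Origin (suc n)) (lowerLastMax-doublePeak l (descending⇒bounded d))
  (lowered
    (subst (IsComposition (3 + n)) (++-assoc α (m ∷ []) (m ∷ β))
      (raise-composition (α ∷ʳ m) (subst (IsComposition (2 + n)) (sym (++-assoc α (m ∷ []) (k ∷ β))) c)))
    (doublePeak α m β (flanks as l (Linked.tail d) (descending⇒bounded d))))

-- Counting through the two maps.

unimodals : ℕ → List (List ℕ)
unimodals n = filter unimodal? (compositions n)

unimodalsWithMax : ℕ → ℕ → List (List ℕ)
unimodalsWithMax k n =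
  filter (λ xs → unimodal? xs ×-dec (maxMultiplicity xs ≟ k)) (compositions n)

∈-unimodals : ∀ n → xs ∈ unimodals n ⇔ (IsComposition n xs × LastPeak xs)
∈-unimodals n = mk⇔
  (λ i → let j , u = ∈-filter⁻ unimodal? {xs = compositions n} i in
         Equivalence.to (∈-compositions n _) j , unimodal⇒lastPeak _ u)
  (λ (c , p) → ∈-filter⁺ unimodal? (Equivalence.from (∈-compositions n _) c) (lastPeak⇒unimodal p))

∈-unimodalsWithMax : ∀ {k} {P : List ℕ → Set} →
                     (∀ xs → (Unimodal xs × maxMultiplicity xs ≡ k) ⇔ P xs) →
                     ∀ n → xs ∈ unimodalsWithMax k n ⇔ (IsComposition n xs × P xs)
∈-unimodalsWithMax {k = k} e n = mk⇔
  (λ i → let j , u = ∈-filter⁻ P? {xs = compositions n} i in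
         Equivalence.to (∈-compositions n _) j , Equivalence.to (e _) u)
  (λ (c , p) → ∈-filter⁺ P? (Equivalence.from (∈-compositions n _) c) (Equivalence.from (e _) p))
  where
  P? : ∀ xs → Dec (Unimodal xs × maxMultiplicity xs ≡ k)
  P? xs = unimodal? xs ×-dec (maxMultiplicity xs ≟ k)

module _ (n : ℕ) where
  private
    -- `N` is positive: for 0 the composition 1, 1 would be lowered to 1, 0.
    N  = suc n
    U₀ = unimodals N
    U₁ = unimodalsWithMax 1 (suc N)
    U₂ = unimodalsWithMax 2 (2 + N)

    to₀ : xs ∈ U₀ → IsComposition N xs × LastPeak xs
    to₀ = Equivalence.to (∈-unimodals N)

    to₂ : xs ∈ U₂ → IsComposition (2 + N) xs × DoublePeak xs
    to₂ = Equivalence.to (∈-unimodalsWithMax doublePeak⇔ (2 + N))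

    ∈-U₁ : xs ∈ U₁ ⇔ (IsComposition (suc N) xs × SinglePeak xs)
    ∈-U₁ = ∈-unimodalsWithMax singlePeak⇔ (suc N)

    images : List (List ℕ)
    images = map raiseLastMax U₀ ++ map lowerLastMax U₂

    images-unique : Unique images
    images-unique = Unique.++⁺
      (Unique-map lowerLastMax (lowerLastMax∘raiseLastMax ∘ proj₂ ∘ to₀)
        (Unique.filter⁺ _ (compositions-unique N)))
      (Unique-map doubleMax
        (λ i → let (nz , _) , p = to₂ i in doubleMax∘lowerLastMax nz p)
        (Unique.filter⁺ _ (compositions-unique (2 + N))))
      disjoint
      where
      disjoint : Disjoint (map raiseLastMax U₀) (map lowerLastMax U₂)
      disjoint (i , j) with ∈-map⁻ raiseLastMax i | ∈-map⁻ lowerLastMax j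
      ... | xs , i′ , e | ys , j′ , e′ =
        let (nz , _) , q = to₂ j′ in raise≢lower (proj₂ (to₀ i′)) nz q (trans (sym e) e′)

    -- Surjectivity is `origin`; conversely both maps land among single-peaked compositions. Neither
    -- list has repetitions, so the lengths agree.
    U₁∼images : U₁ ∼[ set ] images
    U₁∼images = mk⇔ (to ∘ uncurry origin ∘ Equivalence.to ∈-U₁) from
      where
      to : Origin N xs → xs ∈ images
      to (raised c p)  = ∈-++⁺ˡ (∈-map⁺ raiseLastMax (Equivalence.from (∈-unimodals N) (c , p)))
      to (lowered c p) = ∈-++⁺ʳ _ (∈-map⁺ lowerLastMax
        (Equivalence.from (∈-unimodalsWithMax doublePeak⇔ (2 + N)) (c , p)))

      from : xs ∈ images → xs ∈ U₁
      from i with ∈-++⁻ (map raiseLastMax U₀) i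
      ... | inj₁ j with ∈-map⁻ raiseLastMax j
      ...   | _ , k , refl = Equivalence.from ∈-U₁ (uncurry raise-singlePeak (to₀ k))
      from i | inj₂ j with ∈-map⁻ lowerLastMax j
      ...   | _ , k , refl = Equivalence.from ∈-U₁ (uncurry lower-singlePeak (to₂ k))

  u₁≡u₀+u₂ : u 1 N ≡ u 0 N + u 2 N
  u₁≡u₀+u₂ = begin
    -- `u` lists compositions of `N + 1`, while the sum lemmas are phrased with `suc N`.
    u 1 N                    ≡⟨ cong (length ∘ unimodalsWithMax 1) (+-comm N 1) ⟩
    length U₁                ≡⟨ length-set-≡ (Unique.filter⁺ _ (compositions-unique (suc N)))
                                             images-unique U₁∼images ⟩
    length images            ≡⟨ length-++ (map raiseLastMax U₀) ⟩
    length (map raiseLastMax U₀) + length (map lowerLastMax U₂)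
                             ≡⟨ cong₂ _+_ (length-map raiseLastMax U₀) (length-map lowerLastMax U₂) ⟩
    length U₀ + length U₂    ≡⟨ cong (λ k → u 0 N + length (unimodalsWithMax 2 k)) (+-comm 2 N) ⟩
    u 0 N + u 2 N            ∎
    where open ≡-Reasoning

theorem1p1 : (n : ℕ) → + u 0 n ≡ + u 1 n - + u 2 n
-- By evaluation `0 = 1 - 1`, the two ones counting the lists 1 and 1, 1.
theorem1p1 zero    = refl
theorem1p1 (suc n) = sym (begin
  + u 1 (suc n) - + u 2 (suc n)              ≡⟨ m-n≡m⊖n (u 1 (suc n)) (u 2 (suc n)) ⟩
  u 1 (suc n) ⊖ u 2 (suc n)                  ≡⟨ cong (_⊖ u 2 (suc n)) (u₁≡u₀+u₂ n) ⟩
  (u 0 (suc n) + u 2 (suc n)) ⊖ u 2 (suc n)  ≡⟨ ⊖-≥ (m≤n+m (u 2 (suc n)) (u 0 (suc n))) ⟩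
  + (u 0 (suc n) + u 2 (suc n) ∸ u 2 (suc n)) ≡⟨ cong +_ (m+n∸n≡m (u 0 (suc n)) (u 2 (suc n))) ⟩
  + u 0 (suc n)                              ∎)
  where open ≡-Reasoning
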